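{- For every positive integer $n$, $$2^n\hat{A}_n(x)=\sum_{\sigma\in\mathfrak{S}_n}(1+x)^{\mathrm{dda}(\sigma)}\,2^{\mathrm{val}(\sigma)}\,(1+x^2)^{\mathrm{pk}(\sigma)},$$ where the statistics on the right are computed with the convention $\sigma(0)=\sigma(n+1)=n+1$, and $$\hat{B}_n(x)=\sum_{\sigma\in\mathfrak{S}_n^0}(1+x)^{\mathrm{dda}(\sigma)}\,2^{\mathrm{val}(\sigma)}\,(1+x^2)^{\mathrm{pk}(\sigma)},$$ where the statistics on the right are computed with the convention $\sigma(0)=0$, $\sigma(n+1)=n+1$.
   Context: $\mathfrak{S}_n$ is the symmetric group on $[n]=\{1,\dots,n\}$. For $\sigma\in\mathfrak{S}_n$, an index $i\in[n-1]$ is an alternating descent if either $i$ is odd and $\sigma(i)>\sigma(i+1)$, or $i$ is even and $\sigma(i)<\sigma(i+1)$; $\hat d(\sigma)$ is the number of alternating descents and $\hat{A}_n(x)=\sum_{\sigma\in\mathfrak{S}_n}x^{\hat d(\sigma)}$. $\mathcal{B}_n$ is the set of signed permutations of $[n]$, i.e. words $\sigma(1)\cdots\sigma(n)$ with entries in $\{\pm1,\dots,\pm n\}$ such that $|\sigma(1)|\cdots|\sigma(n)|\in\mathfrak{S}_n$ (so $|\mathcal{B}_n|=2^n n!$). Set $\sigma(0)=0$. A position $i\in\{0,1,\dots,n-1\}$ is a type B alternating descent of $\sigma$ if either $i$ is even and $\sigma(i)<\sigma(i+1)$, or $i$ is odd and $\sigma(i)>\sigma(i+1)$; $\hat d_B(\sigma)$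 is their number, and $\hat{B}_n(x)=\sum_{\sigma\in\mathcal{B}_n}x^{\hat d_B(\sigma)}$. $\mathfrak{S}_n$ denotes permutations with the convention $\sigma(0)=\sigma(n+1)=n+1$, and $\mathfrak{S}_n^0$ denotes permutations of $[n]$ with the convention $\sigma(0)=0$, $\sigma(n+1)=n+1$. For such $\sigma$, $i\in[n]$ is a double ascent if $\sigma(i-1)<\sigma(i)<\sigma(i+1)$, a double descent if $\sigma(i-1)>\sigma(i)>\sigma(i+1)$, a valley if $\sigma(i-1)>\sigma(i)<\sigma(i+1)$, a peak if $\sigma(i-1)<\sigma(i)>\sigma(i+1)$. $\mathrm{val}(\sigma)$, $\mathrm{pk}(\sigma)$ are the numbers of valleys and peaks, and $\mathrm{dda}(\sigma)$ is the number of double ascents plus the number of double descents. -}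

module Defs where

open import Data.Nat as ℕ using (ℕ; zero; suc)
open import Data.Integer as ℤ using (ℤ; +_; -[1+_]; ∣_∣)
open import Data.List using (List; []; _∷_; _++_; map; concatMap; filter; foldr; upTo; length; sum)
open import Data.Bool using (Bool; true; false; _∧_; if_then_else_)
open import Relation.Nullary.Decidable using (⌊_⌋; does)
open import Relation.Binary.PropositionalEquality using (_≡_)

-- Polynomials in x with natural-number coefficients, as little-endian
-- coefficient lists ([a₀, a₁, …] = a₀ + a₁ x + …).

Poly : Set
Poly = List ℕ

coeff : Poly → ℕ → ℕ
coeff []       _       = 0
coeff (a ∷ p)  zero    = a
coeff (a ∷ p)  (suc k) = coeff p k

infixl 6 _+P_
infixl 7 _*P_ _·P_

_+P_ : Poly → Poly → Poly
[]      +P q       = q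
p       +P []      = p
(a ∷ p) +P (b ∷ q) = (a ℕ.+ b) ∷ (p +P q)

_·P_ : ℕ → Poly → Poly
c ·P p = map (c ℕ.*_) p

_*P_ : Poly → Poly → Poly
[]      *P q = []
(a ∷ p) *P q = (a ·P q) +P (0 ∷ (p *P q))

oneP : Poly
oneP = 1 ∷ []

xpow : ℕ → Poly
xpow zero    = oneP
xpow (suc k) = 0 ∷ xpow k

_^P_ : Poly → ℕ → Poly
p ^P zero  = oneP
p ^P suc k = p *P (p ^P k)

sumP : List Poly → Poly
sumP = foldr _+P_ []

_≈P_ : Poly → Poly → Set
p ≈P q = ∀ k → coeff p k ≡ coeff q k

words : List ℤ → ℕ → List (List ℤ)
words A zero    = [] ∷ []
words A (suc n) = concatMap (λ a → map (a ∷_) (words A n)) A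

range : ℕ → List ℤ
range n = map (λ i → + suc i) (upTo n)

count : ℤ → List ℤ → ℕ
count a w = length (filter (λ b → a ℤ.≟ b) w)

-- a word of length n is a permutation of [n] iff each i ∈ [n] occurs exactly once
isPerm : ℕ → List ℤ → Bool
isPerm n w = foldr (λ i b → ⌊ count i w ℕ.≟ 1 ⌋ ∧ b) true (range n)

Sym : ℕ → List (List ℤ)
Sym n = filter (λ w → isPerm n w ≟b true) (words (range n) n)
  where
  open import Data.Bool.Properties renaming (_≟_ to _≟b_)

signedRange : ℕ → List ℤ
signedRange n = range n ++ map ℤ.-_ (range n)

absW : List ℤ → List ℤ
absW = map (λ a → + ∣ a ∣)

SignedSym : ℕ → List (List ℤ)
SignedSym n = filter (λ w → isPerm n (absW w) ≟b true) (words (signedRange n) n)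
  where
  open import Data.Bool.Properties renaming (_≟_ to _≟b_)

b2n : Bool → ℕ
b2n true  = 1
b2n false = 0

lt : ℤ → ℤ → Bool
lt a b = ⌊ a ℤ.<? b ⌋

even : ℕ → Bool
even zero          = true
even (suc zero)    = false
even (suc (suc k)) = even k

evenAscOddDes : ℕ → List ℤ → ℕ
evenAscOddDes i []           = 0
evenAscOddDes i (a ∷ [])     = 0
evenAscOddDes i (a ∷ b ∷ w)  =
  b2n (if even i then lt a b else lt b a) ℕ.+ evenAscOddDes (suc i) (b ∷ w)

-- alternating descents of σ ∈ 𝔖_n: i ∈ [n-1], i odd & σ(i)>σ(i+1), or i even & σ(i)<σ(i+1).
-- Positions start at 1 here; "i odd & descent or i even & ascent" equals
-- evenAscOddDes started at index 1 (odd indices: descent, even: ascent).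
altDes : List ℤ → ℕ
altDes σ = evenAscOddDes 1 σ

-- type B alternating descents: with σ(0)=0, positions i ∈ {0,…,n-1},
-- i even & σ(i)<σ(i+1), or i odd & σ(i)>σ(i+1).
altDesB : List ℤ → ℕ
altDesB σ = evenAscOddDes 0 (+ 0 ∷ σ)

record Stats : Set where
  constructor stats
  field
    dda : ℕ
    val : ℕ
    pk  : ℕ

addStats : Stats → Stats → Stats
addStats (stats a b c) (stats a' b' c') = stats (a ℕ.+ a') (b ℕ.+ b') (c ℕ.+ c')

classify : ℤ → ℤ → ℤ → Stats
classify a b c with lt a b | lt b c
... | true  | true  = stats 1 0 0
... | false | false = stats 1 0 0
... | false | true  = stats 0 1 0
... | true  | false = stats 0 0 1

triples : List ℤ → Stats
triples (a ∷ b ∷ c ∷ w) = addStats (classify a b c) (triples (b ∷ c ∷ w))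
triples _               = stats 0 0 0

statsInf : ℕ → List ℤ → Stats
statsInf n σ = triples ((+ suc n) ∷ σ ++ ((+ suc n) ∷ []))

statsZero : ℕ → List ℤ → Stats
statsZero n σ = triples ((+ 0) ∷ σ ++ ((+ suc n) ∷ []))

Ahat : ℕ → Poly
Ahat n = sumP (map (λ σ → xpow (altDes σ)) (Sym n))

Bhat : ℕ → Poly
Bhat n = sumP (map (λ σ → xpow (altDesB σ)) (SignedSym n))

weight : Stats → Poly
weight (stats d v p) =
  ((1 ∷ 1 ∷ []) ^P d) *P ((2 ℕ.^ v) ·P ((1 ∷ 0 ∷ 1 ∷ []) ^P p))

RHSA : ℕ → Poly
RHSA n = sumP (map (λ σ → weight (statsInf n σ)) (Sym n))

RHSB : ℕ → Poly
RHSB n = sumP (map (λ σ → weight (statsZero n σ)) (Sym n))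

-- In a signed word, the comparison of two adjacent letters is decided by the
-- sign of the one with the larger absolute value. So for a fixed permutation
-- |τ| = σ the 2ⁿ choices of signs act independently: the sign of a valley
-- affects no comparison (factor 2), that of a double ascent or descent affects
-- one (factor 1 + x), and that of a peak affects the two around it, which are
-- at positions of opposite parity and hence both alternating or both not
-- (factor 1 + x²). Taking σ(0) = 0 gives the type B identity term by term.
-- Without the comparison at position 0 the same argument evaluates the sum of
-- x^altDes over all signed permutations. That sum is 2ⁿ Âₙ, because the signed
-- permutations with a given set of values ±1, …, ±n correspond to 𝔖ₙ by the
-- increasing bijection, which preserves altDes.
module Submission where

open import Defs
open import Data.Bool using (Bool; true; false; not; _∧_; if_then_else_)
import Data.Bool.Properties as Bool
open import Data.Integer as ℤ using (ℤ; ∣_∣; 0ℤ)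
import Data.Integer.Properties as ℤ
open import Data.List using (List; []; _∷_; _++_; map; concatMap; filter; upTo; length; foldr; zip)
open import Data.List.Properties using (map-++; upTo-∷ʳ; ++-assoc; length-++; length-map)
open import Data.List.Membership.Propositional using (_∈_; _∉_)
open import Data.List.Membership.Propositional.Properties
  using (∈-map⁻; ∈-++⁻; ∈-filter⁻)
open import Data.List.Relation.Binary.Permutation.Propositional using (_↭_; refl; prep; swap; trans; ↭-sym)
import Data.List.Relation.Binary.Permutation.Propositional.Properties as Perm
open import Data.List.Relation.Binary.Pointwise as Pointwise using (Pointwise; []; _∷_)
open import Data.List.Relation.Unary.All as All using (All; []; _∷_)
import Data.List.Relation.Unary.All.Properties as All
open import Data.List.Relation.Unary.AllPairs as AllPairs using (AllPairs; []; _∷_)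
import Data.List.Relation.Unary.AllPairs.Properties as AllPairs
open import Data.List.Relation.Unary.Any using (here; there)
open import Data.Nat as ℕ using (ℕ; zero; suc; _+_; _*_; _^_; _≤_; z≤n; s≤s)
import Data.Nat.Properties as ℕ
open import Data.Nat.Tactic.RingSolver using (solve-∀)
open import Data.Product using (_×_; _,_; proj₁; proj₂)
open import Data.Sum using (_⊎_; inj₁; inj₂)
open import Function using (_∘_; id)
open import Relation.Binary using (tri<; tri≈; tri>)
open import Relation.Binary.PropositionalEquality
  using (_≡_; _≢_; refl; sym; ≢-sym; cong; cong₂; subst; _≗_; module ≡-Reasoning)
  renaming (trans to ≡-trans)
open import Relation.Nullary using (yes; no; contradiction)
open import Relation.Nullary.Decidable using (⌊_⌋; dec-true; dec-false; isYes≗does)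

open ≡-Reasoning

private variable
  A B : Set

-- Finite sums over lists.

∑ : List A → (A → ℕ) → ℕ
∑ []       f = 0
∑ (a ∷ as) f = f a + ∑ as f

∑-cong : (as : List A) {f g : A → ℕ} → (∀ {a} → a ∈ as → f a ≡ g a) → ∑ as f ≡ ∑ as g
∑-cong []       eq = refl
∑-cong (a ∷ as) eq = cong₂ _+_ (eq (here refl)) (∑-cong as (eq ∘ there))

∑-++ : (as bs : List A) (f : A → ℕ) → ∑ (as ++ bs) f ≡ ∑ as f + ∑ bs f
∑-++ []       bs f = refl
∑-++ (a ∷ as) bs f =
  ≡-trans (cong (f a +_) (∑-++ as bs f)) (sym (ℕ.+-assoc (f a) (∑ as f) (∑ bs f)))

∑-map : (h : A → B) (as : List A) (f : B → ℕ) → ∑ (map h as) f ≡ ∑ as (f ∘ h)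
∑-map h []       f = refl
∑-map h (a ∷ as) f = cong (f (h a) +_) (∑-map h as f)

∑-concatMap : (h : A → List B) (as : List A) (f : B → ℕ) →
  ∑ (concatMap h as) f ≡ ∑ as (λ a → ∑ (h a) f)
∑-concatMap h []       f = refl
∑-concatMap h (a ∷ as) f =
  ≡-trans (∑-++ (h a) (concatMap h as) f) (cong (∑ (h a) f +_) (∑-concatMap h as f))

∑-+ : (as : List A) (f g : A → ℕ) → ∑ as (λ a → f a + g a) ≡ ∑ as f + ∑ as g
∑-+ []       f g = refl
∑-+ (a ∷ as) f g rewrite ∑-+ as f g = interchange (f a) (g a) (∑ as f) (∑ as g)
  where
  interchange : ∀ x y z w → (x + y) + (z + w) ≡ (x + z) + (y + w)
  interchange = solve-∀

∑-zero : (as : List A) → ∑ as (λ _ → 0) ≡ 0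
∑-zero []       = refl
∑-zero (a ∷ as) = ∑-zero as

∑-const : (as : List A) (c : ℕ) → ∑ as (λ _ → c) ≡ length as * c
∑-const []       c = refl
∑-const (a ∷ as) c = cong (c +_) (∑-const as c)

∑-*ʳ : (as : List A) (f : A → ℕ) (c : ℕ) → ∑ as f * c ≡ ∑ as (λ a → f a * c)
∑-*ʳ []       f c = refl
∑-*ʳ (a ∷ as) f c =
  ≡-trans (ℕ.*-distribʳ-+ c (f a) (∑ as f)) (cong (f a * c +_) (∑-*ʳ as f c))

∑-*ˡ : (as : List A) (f : A → ℕ) (c : ℕ) → c * ∑ as f ≡ ∑ as (λ a → c * f a)
∑-*ˡ []       f c = ℕ.*-zeroʳ c
∑-*ˡ (a ∷ as) f c =
  ≡-trans (ℕ.*-distribˡ-+ c (f a) (∑ as f)) (cong (c * f a +_) (∑-*ˡ as f c))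

∑-swap : (as : List A) (bs : List B) (f : A → B → ℕ) →
  ∑ as (λ a → ∑ bs (f a)) ≡ ∑ bs (λ b → ∑ as (λ a → f a b))
∑-swap []       bs f = sym (∑-zero bs)
∑-swap (a ∷ as) bs f =
  ≡-trans (cong (∑ bs (f a) +_) (∑-swap as bs f))
          (sym (∑-+ bs (f a) (λ b → ∑ as (λ a′ → f a′ b))))

∑-filter : (p : A → Bool) (as : List A) (f : A → ℕ) →
  ∑ (filter (λ a → p a Bool.≟ true) as) f ≡ ∑ as (λ a → b2n (p a) * f a)
∑-filter p []       f = refl
∑-filter p (a ∷ as) f with p a
... | true  = cong₂ _+_ (sym (ℕ.+-identityʳ (f a))) (∑-filter p as f)
... | false = ∑-filter p as f

∑-↭ : {as bs : List A} (f : A → ℕ) → as ↭ bs → ∑ as f ≡ ∑ bs f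
∑-↭ f refl          = refl
∑-↭ f (prep x p)    = cong (f x +_) (∑-↭ f p)
∑-↭ f (swap {xs} {ys} x y p) rewrite ∑-↭ f p = exchange (f x) (f y) (∑ ys f)
  where
  exchange : ∀ u v w → u + (v + w) ≡ v + (u + w)
  exchange = solve-∀
∑-↭ f (trans p q)   = ≡-trans (∑-↭ f p) (∑-↭ f q)

∑-Pointwise : {R : A → B → Set} {as : List A} {bs : List B} {f : A → ℕ} {g : B → ℕ} →
  Pointwise R as bs → (∀ {a b} → R a b → f a ≡ g b) → ∑ as f ≡ ∑ bs g
∑-Pointwise []       eq = refl
∑-Pointwise (r ∷ rs) eq = cong₂ _+_ (eq r) (∑-Pointwise rs eq)

-- Polynomials through their coefficient sequences.

Series : Set
Series = ℕ → ℕ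

-- Multiplication by x. Accordingly `shiftIf b` is multiplication by x to the power `b2n b`.
shift : Series → Series
shift g zero    = 0
shift g (suc k) = g k

shiftIf : Bool → Series → Series
shiftIf true  g = shift g
shiftIf false g = g

shift-cong : ∀ {f g} → f ≗ g → shift f ≗ shift g
shift-cong eq zero    = refl
shift-cong eq (suc k) = eq k

shiftIf-cong : ∀ b {f g} → f ≗ g → shiftIf b f ≗ shiftIf b g
shiftIf-cong true  = shift-cong
shiftIf-cong false eq = eq

shift-+ : ∀ f g k → shift (λ j → f j + g j) k ≡ shift f k + shift g k
shift-+ f g zero    = refl
shift-+ f g (suc k) = refl

shiftIf-+ : ∀ b f g k → shiftIf b (λ j → f j + g j) k ≡ shiftIf b f k + shiftIf b g k
shiftIf-+ true  f g k = shift-+ f g k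
shiftIf-+ false f g k = refl

shiftIf-∑ : ∀ b (as : List A) (f : A → Series) k →
  ∑ as (λ a → shiftIf b (f a) k) ≡ shiftIf b (λ j → ∑ as (λ a → f a j)) k
shiftIf-∑ false as f k       = refl
shiftIf-∑ true  as f zero    = ∑-zero as
shiftIf-∑ true  as f (suc k) = refl

coeff-+P : ∀ p q k → coeff (p +P q) k ≡ coeff p k + coeff q k
coeff-+P []      q       k       = refl
coeff-+P (a ∷ p) []      k       = sym (ℕ.+-identityʳ _)
coeff-+P (a ∷ p) (b ∷ q) zero    = refl
coeff-+P (a ∷ p) (b ∷ q) (suc k) = coeff-+P p q k

coeff-·P : ∀ c p k → coeff (c ·P p) k ≡ c * coeff p k
coeff-·P c []      k       = sym (ℕ.*-zeroʳ c)
coeff-·P c (a ∷ p) zero    = refl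
coeff-·P c (a ∷ p) (suc k) = coeff-·P c p k

coeff-0∷ : ∀ p → coeff (0 ∷ p) ≗ shift (coeff p)
coeff-0∷ p zero    = refl
coeff-0∷ p (suc k) = refl

coeff-sumP : (h : A → Poly) (as : List A) (k : ℕ) →
  coeff (sumP (map h as)) k ≡ ∑ as (λ a → coeff (h a) k)
coeff-sumP h []       k = refl
coeff-sumP h (a ∷ as) k =
  ≡-trans (coeff-+P (h a) (sumP (map h as)) k) (cong (coeff (h a) k +_) (coeff-sumP h as k))

coeff-xpow-b2n : ∀ b m → coeff (xpow (b2n b + m)) ≗ shiftIf b (coeff (xpow m))
coeff-xpow-b2n true  m = coeff-0∷ (xpow m)
coeff-xpow-b2n false m k = refl

-- The Cauchy product, with a coefficient function as second factor: identities then hold pointwise,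
-- while lists with equal coefficients may differ in trailing zeros.
conv : Poly → Series → Series
conv []      g k = 0
conv (a ∷ p) g k = a * g k + shift (conv p g) k

coeff-*P : ∀ p q → coeff (p *P q) ≗ conv p (coeff q)
coeff-*P []      q k = refl
coeff-*P (a ∷ p) q k = begin
  coeff ((a ·P q) +P (0 ∷ p *P q)) k             ≡⟨ coeff-+P (a ·P q) (0 ∷ p *P q) k ⟩
  coeff (a ·P q) k + coeff (0 ∷ p *P q) k
    ≡⟨ cong₂ _+_ (coeff-·P a q k) (≡-trans (coeff-0∷ (p *P q) k) (shift-cong (coeff-*P p q) k)) ⟩
  a * coeff q k + shift (conv p (coeff q)) k     ∎

conv-cong : ∀ p {f g} → f ≗ g → conv p f ≗ conv p g
conv-cong []      eq k = refl
conv-cong (a ∷ p) eq k = cong₂ _+_ (cong (a *_) (eq k)) (shift-cong (conv-cong p eq) k)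

conv-+ : ∀ p f g k → conv p (λ j → f j + g j) k ≡ conv p f k + conv p g k
conv-+ []      f g k = refl
conv-+ (a ∷ p) f g k
  rewrite shift-cong (conv-+ p f g) k | shift-+ (conv p f) (conv p g) k
  = regroup a (f k) (g k) (shift (conv p f) k) (shift (conv p g) k)
  where
  regroup : ∀ a x y z w → a * (x + y) + (z + w) ≡ (a * x + z) + (a * y + w)
  regroup = solve-∀

conv-shift : ∀ p g → conv p (shift g) ≗ shift (conv p g)
conv-shift []      g zero    = refl
conv-shift []      g (suc k) = refl
conv-shift (a ∷ p) g zero    = cong (_+ 0) (ℕ.*-zeroʳ a)
conv-shift (a ∷ p) g (suc k) = cong (a * g k +_) (conv-shift p g k)

conv-+P : ∀ p q g k → conv (p +P q) g k ≡ conv p g k + conv q g k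
conv-+P []      q       g k = refl
conv-+P (a ∷ p) []      g k = sym (ℕ.+-identityʳ _)
conv-+P (a ∷ p) (b ∷ q) g k
  rewrite shift-cong (conv-+P p q g) k | shift-+ (conv p g) (conv q g) k
  = regroup a b (g k) (shift (conv p g) k) (shift (conv q g) k)
  where
  regroup : ∀ a b x z w → (a + b) * x + (z + w) ≡ (a * x + z) + (b * x + w)
  regroup = solve-∀

conv-1·P : ∀ p g → conv (1 ·P p) g ≗ conv p g
conv-1·P []      g k = refl
conv-1·P (a ∷ p) g k =
  cong₂ _+_ (cong (_* g k) (ℕ.*-identityˡ a)) (shift-cong (conv-1·P p g) k)

conv-1+x : ∀ p g k → conv ((1 ∷ 1 ∷ []) *P p) g k ≡ conv p g k + shift (conv p g) k
conv-1+x p g k = begin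
  conv ((1 ·P p) +P (0 ∷ q)) g k
    ≡⟨ conv-+P (1 ·P p) (0 ∷ q) g k ⟩
  conv (1 ·P p) g k + shift (conv q g) k
    ≡⟨ cong₂ _+_ (conv-1·P p g k) (shift-cong conv-q k) ⟩
  conv p g k + shift (conv p g) k ∎
  where
  -- This is `(1 ∷ []) *P p` unfolded; the summand `0 ∷ []` comes from `[] *P p` and contributes
  -- nothing.
  q = (1 ·P p) +P (0 ∷ [])

  conv-0 : conv (0 ∷ []) g ≗ λ _ → 0
  conv-0 zero    = refl
  conv-0 (suc k) = refl

  conv-q : conv q g ≗ conv p g
  conv-q j = begin
    conv q g j                              ≡⟨ conv-+P (1 ·P p) (0 ∷ []) g j ⟩
    conv (1 ·P p) g j + conv (0 ∷ []) g j   ≡⟨ cong₂ _+_ (conv-1·P p g j) (conv-0 j) ⟩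
    conv p g j + 0                          ≡⟨ ℕ.+-identityʳ _ ⟩
    conv p g j                              ∎

coeff-1+x² : ∀ p k → coeff ((1 ∷ 0 ∷ 1 ∷ []) *P p) k ≡ coeff p k + shift (shift (coeff p)) k
coeff-1+x² p k = ≡-trans (coeff-*P (1 ∷ 0 ∷ 1 ∷ []) p k) (expand k)
  where
  simplify : ∀ x y → 1 * x + (1 * y + 0) ≡ x + y
  simplify = solve-∀

  expand : ∀ k → conv (1 ∷ 0 ∷ 1 ∷ []) (coeff p) k ≡ coeff p k + shift (shift (coeff p)) k
  expand zero                = cong (_+ 0) (ℕ.*-identityˡ _)
  expand (suc zero)          = cong (_+ 0) (ℕ.*-identityˡ _)
  expand (suc (suc zero))    = simplify (coeff p 2) (coeff p 0)
  expand (suc (suc (suc k))) = simplify (coeff p (3 + k)) (coeff p (1 + k))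

-- Recurrences for the weight.

W : Stats → Series
W s = coeff (weight s)

private
  X Q : ℕ → Poly
  X d = (1 ∷ 1 ∷ []) ^P d
  Q p = (1 ∷ 0 ∷ 1 ∷ []) ^P p

W-0 : ∀ k → coeff oneP k + 0 ≡ W (stats 0 0 0) k
W-0 zero    = refl
W-0 (suc k) = refl

W-conv : ∀ d v p k → W (stats d v p) k ≡ conv (X d) (λ j → 2 ^ v * coeff (Q p) j) k
W-conv d v p k =
  ≡-trans (coeff-*P (X d) ((2 ^ v) ·P Q p) k) (conv-cong (X d) (coeff-·P (2 ^ v) (Q p)) k)

-- The factors 1 + x here, 2 in `W-val` and 1 + x² in `W-pk` are written as sums of two terms, one
-- for each sign of the letter.
W-dda : ∀ t k → W (addStats (stats 1 0 0) t) k ≡ W t k + shift (W t) k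
W-dda (stats d v p) k = begin
  W (stats (suc d) v p) k           ≡⟨ W-conv (suc d) v p k ⟩
  conv (X (suc d)) g k              ≡⟨ conv-1+x (X d) g k ⟩
  conv (X d) g k + shift (conv (X d) g) k
    ≡⟨ cong₂ _+_ (sym (W-conv d v p k)) (shift-cong (sym ∘ W-conv d v p) k) ⟩
  W (stats d v p) k + shift (W (stats d v p)) k ∎
  where
  g = λ j → 2 ^ v * coeff (Q p) j

W-val : ∀ t k → W (addStats (stats 0 1 0) t) k ≡ W t k + W t k
W-val (stats d v p) k = begin
  W (stats d (suc v) p) k                            ≡⟨ W-conv d (suc v) p k ⟩
  conv (X d) (λ j → 2 * 2 ^ v * coeff (Q p) j) k
    ≡⟨ conv-cong (X d) (λ j → double (2 ^ v) (coeff (Q p) j)) k ⟩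
  conv (X d) (λ j → g j + g j) k                     ≡⟨ conv-+ (X d) g g k ⟩
  conv (X d) g k + conv (X d) g k
    ≡⟨ cong₂ _+_ (sym (W-conv d v p k)) (sym (W-conv d v p k)) ⟩
  W (stats d v p) k + W (stats d v p) k ∎
  where
  g = λ j → 2 ^ v * coeff (Q p) j

  double : ∀ a b → 2 * a * b ≡ a * b + a * b
  double = solve-∀

-- In `weight` the factor 1 + x² stands inside the product with the power of 1 + x, so both shifts
-- have to be moved out through `conv (X d)`.
W-pk : ∀ t k → W (addStats (stats 0 0 1) t) k ≡ W t k + shift (shift (W t)) k
W-pk (stats d v p) k = begin
  W (stats d v (suc p)) k                            ≡⟨ W-conv d v (suc p) k ⟩
  conv (X d) (λ j → 2 ^ v * coeff (Q (suc p)) j) k   ≡⟨ conv-cong (X d) expand k ⟩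
  conv (X d) (λ j → g j + shift (shift g) j) k       ≡⟨ conv-+ (X d) g (shift (shift g)) k ⟩
  conv (X d) g k + conv (X d) (shift (shift g)) k
    ≡⟨ cong₂ _+_ (sym (W-conv d v p k)) shift² ⟩
  W (stats d v p) k + shift (shift (W (stats d v p))) k ∎
  where
  g = λ j → 2 ^ v * coeff (Q p) j

  scale : ∀ c f → (λ j → c * shift (shift f) j) ≗ shift (shift (λ j → c * f j))
  scale c f zero          = ℕ.*-zeroʳ c
  scale c f (suc zero)    = ℕ.*-zeroʳ c
  scale c f (suc (suc j)) = refl

  expand : ∀ j → 2 ^ v * coeff (Q (suc p)) j ≡ g j + shift (shift g) j
  expand j = begin
    2 ^ v * coeff (Q (suc p)) j
      ≡⟨ cong (2 ^ v *_) (coeff-1+x² (Q p) j) ⟩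
    2 ^ v * (coeff (Q p) j + shift (shift (coeff (Q p))) j)
      ≡⟨ ℕ.*-distribˡ-+ (2 ^ v) (coeff (Q p) j) _ ⟩
    g j + 2 ^ v * shift (shift (coeff (Q p))) j
      ≡⟨ cong (g j +_) (scale (2 ^ v) (coeff (Q p)) j) ⟩
    g j + shift (shift g) j ∎

  shift² : conv (X d) (shift (shift g)) k ≡ shift (shift (W (stats d v p))) k
  shift² = begin
    conv (X d) (shift (shift g)) k         ≡⟨ conv-shift (X d) (shift g) k ⟩
    shift (conv (X d) (shift g)) k         ≡⟨ shift-cong (conv-shift (X d) g) k ⟩
    shift (shift (conv (X d) g)) k
      ≡⟨ shift-cong (shift-cong (sym ∘ W-conv d v p)) k ⟩
    shift (shift (W (stats d v p))) k      ∎

-- Comparisons between signed letters.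

lt-true : ∀ {a b} → a ℤ.< b → lt a b ≡ true
lt-true {a} {b} a<b = ≡-trans (isYes≗does (a ℤ.<? b)) (dec-true (a ℤ.<? b) a<b)

lt-false : ∀ {a b} → b ℤ.≤ a → lt a b ≡ false
lt-false {a} {b} b≤a = ≡-trans (isYes≗does (a ℤ.<? b)) (dec-false (a ℤ.<? b) (ℤ.≤⇒≯ b≤a))

withSign : Bool → ℤ → ℤ
withSign true  a = a
withSign false a = ℤ.- a

withSign-< : ∀ s {a b} → 0ℤ ℤ.≤ a → a ℤ.< b → withSign s a ℤ.< b
withSign-< true  0≤a a<b = a<b
withSign-< false 0≤a a<b = ℤ.≤-<-trans (ℤ.≤-trans (ℤ.neg-mono-≤ 0≤a) 0≤a) a<b

<-withSign : ∀ s {a b} → 0ℤ ℤ.≤ a → a ℤ.< b → ℤ.- b ℤ.< withSign s a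
<-withSign true  {a} {b} 0≤a a<b =
  subst (ℤ.- b ℤ.<_) (ℤ.neg-involutive a) (ℤ.neg-mono-< (withSign-< false 0≤a a<b))
<-withSign false 0≤a a<b = ℤ.neg-mono-< a<b

-- For 0 ≤ a < b both signs of a lie strictly between -b and b, so the sign of b decides. The case a
-- = 0 serves the convention σ(0) = 0.
lt-withSign : ∀ s t {a b} → 0ℤ ℤ.≤ a → a ℤ.< b → lt (withSign s a) (withSign t b) ≡ t
lt-withSign s true  0≤a a<b = lt-true (withSign-< s 0≤a a<b)
lt-withSign s false 0≤a a<b = lt-false (ℤ.<⇒≤ (<-withSign s 0≤a a<b))

lt-withSignʳ : ∀ s t {a b} → 0ℤ ℤ.≤ a → a ℤ.< b → lt (withSign t b) (withSign s a) ≡ not t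
lt-withSignʳ s true  0≤a a<b = lt-false (ℤ.<⇒≤ (withSign-< s 0≤a a<b))
lt-withSignʳ s false 0≤a a<b = lt-true (<-withSign s 0≤a a<b)

altAt : ℕ → ℤ → ℤ → Bool
altAt i a b = if even i then lt a b else lt b a

-- t says whether the comparison at position i is an ascent
alternates : ℕ → Bool → Bool
alternates i t = if even i then t else not t

altAt-< : ∀ i s t {a b} → 0ℤ ℤ.≤ a → a ℤ.< b →
  altAt i (withSign s a) (withSign t b) ≡ alternates i t
altAt-< i s t 0≤a a<b with even i
... | true  = lt-withSign s t 0≤a a<b
... | false = lt-withSignʳ s t 0≤a a<b

-- The larger letter is now on the left, where a positive sign makes a descent; hence `not s`.
altAt-> : ∀ i s t {a b} → 0ℤ ℤ.≤ b → b ℤ.< a →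
  altAt i (withSign s a) (withSign t b) ≡ alternates i (not s)
altAt-> i s t 0≤b b<a with even i
... | true  = lt-withSignʳ t s 0≤b b<a
... | false = ≡-trans (lt-withSign t s 0≤b b<a) (sym (Bool.not-involutive s))

even-suc : ∀ i → even (suc i) ≡ not (even i)
even-suc zero          = refl
even-suc (suc zero)    = refl
even-suc (suc (suc i)) = even-suc i

-- `classify` as a function of the two comparisons alone, so that a known comparison can be
-- substituted.
classifyBy : Bool → Bool → Stats
classifyBy true  true  = stats 1 0 0
classifyBy false false = stats 1 0 0
classifyBy false true  = stats 0 1 0
classifyBy true  false = stats 0 0 1

classify-lt : ∀ a b c → classify a b c ≡ classifyBy (lt a b) (lt b c)
classify-lt a b c with lt a b | lt b c
... | true  | true  = refl
... | false | false = refl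
... | false | true  = refl
... | true  | false = refl

-- A letter preceded by a smaller one takes both signs, positive first. Its sign decides the
-- comparison at `i` and, if `q` is false, also the one at `suc i`. In that case the letter is a
-- peak: the two comparisons go in opposite directions at positions of opposite parity, so both
-- alternate or neither does.
signs-after-ascent : ∀ i q t k →
  shiftIf (alternates i true) (shiftIf (not q ∧ alternates (suc i) false) (W t)) k +
  shiftIf (alternates i false) (shiftIf (not q ∧ alternates (suc i) true) (W t)) k
  ≡ W (addStats (classifyBy true q) t) k
signs-after-ascent i q t k rewrite even-suc i with even i | q
... | true  | true  = ≡-trans (ℕ.+-comm (shift (W t) k) (W t k)) (sym (W-dda t k))
... | true  | false = ≡-trans (ℕ.+-comm (shift (shift (W t)) k) (W t k)) (sym (W-pk t k))
... | false | true  = sym (W-dda t k)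
... | false | false = sym (W-pk t k)

-- The comparison on the left belongs to the larger predecessor; `i` is the position on the right.
-- The sign decides that comparison if `q` is false; otherwise the letter is a valley and both signs
-- give the same term.
signs-after-descent : ∀ i q t k →
  shiftIf (not q ∧ alternates i false) (W t) k + shiftIf (not q ∧ alternates i true) (W t) k
  ≡ W (addStats (classifyBy false q) t) k
signs-after-descent i q t k with even i | q
... | true  | true  = sym (W-val t k)
... | true  | false = sym (W-dda t k)
... | false | true  = sym (W-val t k)
... | false | false = ≡-trans (ℕ.+-comm (shift (W t) k) (W t k)) (sym (W-dda t k))

-- Alternating descents summed over the signings of a word.

signings : List ℤ → List (List ℤ)
signings []      = [] ∷ []
signings (a ∷ u) = map (a ∷_) (signings u) ++ map (ℤ.- a ∷_) (signings u)

∑-signings-∷ : ∀ a u (f : List ℤ → ℕ) →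
  ∑ (signings (a ∷ u)) f ≡ ∑ (signings u) (f ∘ (a ∷_)) + ∑ (signings u) (f ∘ (ℤ.- a ∷_))
∑-signings-∷ a u f =
  ≡-trans (∑-++ (map (a ∷_) (signings u)) _ f)
          (cong₂ _+_ (∑-map (a ∷_) (signings u) f) (∑-map (ℤ.- a ∷_) (signings u) f))

altSeries : ℕ → ℤ → List ℤ → Series
altSeries i a u k = ∑ (signings u) (λ w → coeff (xpow (evenAscOddDes i (a ∷ w))) k)

altSeries-∷ : ∀ i a b u k → altSeries i a (b ∷ u) k ≡
  shiftIf (altAt i a b) (altSeries (suc i) b u) k +
  shiftIf (altAt i a (ℤ.- b)) (altSeries (suc i) (ℤ.- b) u) k
altSeries-∷ i a b u k =
  ≡-trans (∑-signings-∷ b u _) (cong₂ _+_ (extract b) (extract (ℤ.- b)))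
  where
  extract : ∀ c → ∑ (signings u) (λ w → coeff (xpow (evenAscOddDes i (a ∷ c ∷ w))) k)
                ≡ shiftIf (altAt i a c) (altSeries (suc i) c u) k
  extract c = ≡-trans
    (∑-cong (signings u) (λ {w} _ → coeff-xpow-b2n (altAt i a c) (evenAscOddDes (suc i) (c ∷ w)) k))
    (shiftIf-∑ (altAt i a c) (signings u) _ k)

-- `∞` is the closing letter σ(n + 1) = n + 1. It enters the statistics only; the alternating
-- descents stop before it.
module _ (∞ : ℤ) where

  next : List ℤ → ℤ
  next []      = ∞
  next (b ∷ u) = b

  triples-∷ : ∀ a b u → triples (a ∷ b ∷ u ++ ∞ ∷ []) ≡
    addStats (classifyBy (lt a b) (lt b (next u))) (triples (b ∷ u ++ ∞ ∷ []))
  triples-∷ a b []      = cong (λ s → addStats s (stats 0 0 0)) (classify-lt a b ∞)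
  triples-∷ a b (c ∷ u) = cong (λ s → addStats s (triples (b ∷ c ∷ u ++ ∞ ∷ []))) (classify-lt a b c)

  Between : ℤ → Set
  Between b = 0ℤ ℤ.< b × b ℤ.< ∞

  -- If the letter after a is smaller than a, the comparison between the two is
  -- decided by the sign s of a; all other comparisons are accounted for by W.
  altSeries-W : ∀ i s a u → 0ℤ ℤ.≤ a → a ℤ.< ∞ → All Between u → AllPairs _≢_ (a ∷ u) →
    altSeries i (withSign s a) u ≗
    shiftIf (not (lt a (next u)) ∧ alternates i (not s)) (W (triples (a ∷ u ++ ∞ ∷ [])))
  -- The letter after a descent with its sign summed out. Besides its use in the induction, this
  -- starts type A, where the first letter follows n + 1 but position 0 is not counted.
  altSeries-descent : ∀ i a b u → b ℤ.< a → All Between (b ∷ u) → AllPairs _≢_ (b ∷ u) → ∀ k →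
    altSeries i b u k + altSeries i (ℤ.- b) u k ≡ W (triples (a ∷ b ∷ u ++ ∞ ∷ [])) k

  altSeries-descent i a b u b<a ((0<b , b<∞) ∷ bu) (b≢ ∷ u≢) k
    rewrite triples-∷ a b u | lt-false (ℤ.<⇒≤ b<a)
          | altSeries-W i true b u (ℤ.<⇒≤ 0<b) b<∞ bu (b≢ ∷ u≢) k
          | altSeries-W i false b u (ℤ.<⇒≤ 0<b) b<∞ bu (b≢ ∷ u≢) k
    = signs-after-descent i (lt b (next u)) (triples (b ∷ u ++ ∞ ∷ [])) k

  -- The last letter is followed by the ascent to `∞`, so the condition on the shift is false.
  altSeries-W i s a [] 0≤a a<∞ _ _ k rewrite lt-true a<∞ = W-0 k
  altSeries-W i s a (b ∷ u) 0≤a a<∞ bu@((0<b , b<∞) ∷ bu′) ((a≢b ∷ _) ∷ u≢) k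
    with ℤ.<-cmp a b
  ... | tri≈ _ a≡b _ = contradiction a≡b a≢b
  -- The comparison at `i` has the same outcome for both signs of `b`, so its power of x factors out
  -- of the sum.
  ... | tri> _ _ b<a rewrite lt-false (ℤ.<⇒≤ b<a) = begin
    altSeries i (withSign s a) (b ∷ u) k
      ≡⟨ altSeries-∷ i (withSign s a) b u k ⟩
    shiftIf (altAt i (withSign s a) b) F k + shiftIf (altAt i (withSign s a) (ℤ.- b)) G k
      ≡⟨ cong₂ (λ p q → shiftIf p F k + shiftIf q G k)
           (altAt-> i s true 0≤b b<a) (altAt-> i s false 0≤b b<a) ⟩
    shiftIf p F k + shiftIf p G k
      ≡⟨ shiftIf-+ p F G k ⟨
    shiftIf p (λ j → F j + G j) k
      ≡⟨ shiftIf-cong p (altSeries-descent (suc i) a b u b<a bu u≢) k ⟩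
    shiftIf p (W (triples (a ∷ b ∷ u ++ ∞ ∷ []))) k ∎
    where
    0≤b = ℤ.<⇒≤ 0<b
    p = alternates i (not s)
    F = altSeries (suc i) b u
    G = altSeries (suc i) (ℤ.- b) u
  -- The comparison at `i` now depends on the sign of `b`; the induction hypothesis supplies the
  -- dependence at `suc i`, and summing over the sign leaves the factor of `b`.
  ... | tri< a<b _ _ rewrite triples-∷ a b u | lt-true a<b = begin
    altSeries i (withSign s a) (b ∷ u) k
      ≡⟨ altSeries-∷ i (withSign s a) b u k ⟩
    shiftIf (altAt i (withSign s a) b) F k + shiftIf (altAt i (withSign s a) (ℤ.- b)) G k
      ≡⟨ cong₂ (λ p q → shiftIf p F k + shiftIf q G k)
           (altAt-< i s true 0≤a a<b) (altAt-< i s false 0≤a a<b) ⟩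
    shiftIf (alternates i true) F k + shiftIf (alternates i false) G k
      ≡⟨ cong₂ _+_
           (shiftIf-cong (alternates i true) (altSeries-W (suc i) true b u 0≤b b<∞ bu′ u≢) k)
           (shiftIf-cong (alternates i false) (altSeries-W (suc i) false b u 0≤b b<∞ bu′ u≢) k) ⟩
    _ ≡⟨ signs-after-ascent i (lt b (next u)) (triples (b ∷ u ++ ∞ ∷ [])) k ⟩
    W (addStats (classifyBy true (lt b (next u))) (triples (b ∷ u ++ ∞ ∷ []))) k ∎
    where
    0≤b = ℤ.<⇒≤ 0<b
    F = altSeries (suc i) b u
    G = altSeries (suc i) (ℤ.- b) u

-- Sums over words and changes of alphabet.

∑-words-suc : ∀ A m (f : List ℤ → ℕ) →
  ∑ (words A (suc m)) f ≡ ∑ A (λ a → ∑ (words A m) (f ∘ (a ∷_)))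
∑-words-suc A m f =
  ≡-trans (∑-concatMap _ A f) (∑-cong A (λ {a} _ → ∑-map (a ∷_) (words A m) f))

∑-words-↭ : ∀ {A B} → A ↭ B → ∀ m (f : List ℤ → ℕ) → ∑ (words A m) f ≡ ∑ (words B m) f
∑-words-↭         A↭B zero    f = refl
∑-words-↭ {A} {B} A↭B (suc m) f = begin
  ∑ (words A (suc m)) f                        ≡⟨ ∑-words-suc A m f ⟩
  ∑ A (λ a → ∑ (words A m) (f ∘ (a ∷_)))       ≡⟨ ∑-cong A (λ _ → ∑-words-↭ A↭B m _) ⟩
  ∑ A (λ a → ∑ (words B m) (f ∘ (a ∷_)))       ≡⟨ ∑-↭ _ A↭B ⟩
  ∑ B (λ a → ∑ (words B m) (f ∘ (a ∷_)))       ≡⟨ ∑-words-suc B m f ⟨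
  ∑ (words B (suc m)) f                        ∎

∑-words-restrict : ∀ A B m (f : List ℤ → ℕ) →
  (∀ {b w} → b ∈ B → b ∈ w → f w ≡ 0) → ∑ (words (A ++ B) m) f ≡ ∑ (words A m) f
∑-words-restrict A B zero    f vanish = refl
∑-words-restrict A B (suc m) f vanish = begin
  ∑ (words (A ++ B) (suc m)) f                 ≡⟨ ∑-words-suc (A ++ B) m f ⟩
  ∑ (A ++ B) F                                 ≡⟨ ∑-++ A B F ⟩
  ∑ A F + ∑ B F
    ≡⟨ cong₂ _+_
         (∑-cong A (λ {a} _ → ∑-words-restrict A B m (f ∘ (a ∷_)) (λ b∈B → vanish b∈B ∘ there)))
         (≡-trans (∑-cong B (λ b∈B →
                    ≡-trans (∑-cong (words (A ++ B) m) (λ _ → vanish b∈B (here refl)))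
                            (∑-zero (words (A ++ B) m))))
                  (∑-zero B)) ⟩
  ∑ A (λ a → ∑ (words A m) (f ∘ (a ∷_))) + 0   ≡⟨ ℕ.+-identityʳ _ ⟩
  ∑ A (λ a → ∑ (words A m) (f ∘ (a ∷_)))       ≡⟨ ∑-words-suc A m f ⟨
  ∑ (words A (suc m)) f                        ∎
  where
  F = λ a → ∑ (words (A ++ B) m) (f ∘ (a ∷_))

∑-words-Pointwise : ∀ {R : ℤ → ℤ → Set} {A B} → Pointwise R A B →
  ∀ m {f g : List ℤ → ℕ} → (∀ {w w′} → Pointwise R w w′ → f w ≡ g w′) →
  ∑ (words A m) f ≡ ∑ (words B m) g
∑-words-Pointwise AB zero    eq = cong (_+ 0) (eq [])
∑-words-Pointwise {A = A} {B} AB (suc m) {f} {g} eq = begin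
  ∑ (words A (suc m)) f                        ≡⟨ ∑-words-suc A m f ⟩
  ∑ A (λ a → ∑ (words A m) (f ∘ (a ∷_)))
    ≡⟨ ∑-Pointwise AB (λ r → ∑-words-Pointwise AB m (λ rs → eq (r ∷ rs))) ⟩
  ∑ B (λ b → ∑ (words B m) (g ∘ (b ∷_)))       ≡⟨ ∑-words-suc B m g ⟨
  ∑ (words B (suc m)) g                        ∎

-- A letter of the doubled alphabet is a letter of `A` together with a sign, chosen independently at
-- each place.
∑-words-signed : ∀ A m (f : List ℤ → ℕ) →
  ∑ (words (A ++ map ℤ.-_ A) m) f ≡ ∑ (words A m) (λ u → ∑ (signings u) f)
∑-words-signed A zero    f = sym (ℕ.+-identityʳ _)
∑-words-signed A (suc m) f = begin
  ∑ (words A± (suc m)) f                       ≡⟨ ∑-words-suc A± m f ⟩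
  ∑ A± (λ a → ∑ (words A± m) (f ∘ (a ∷_)))     ≡⟨ ∑-cong A± (λ _ → ∑-words-signed A m _) ⟩
  ∑ A± F                                       ≡⟨ ∑-++ A (map ℤ.-_ A) F ⟩
  ∑ A F + ∑ (map ℤ.-_ A) F                     ≡⟨ cong (∑ A F +_) (∑-map ℤ.-_ A F) ⟩
  ∑ A F + ∑ A (F ∘ ℤ.-_)                       ≡⟨ ∑-+ A F (F ∘ ℤ.-_) ⟨
  ∑ A (λ a → F a + F (ℤ.- a))
    ≡⟨ ∑-cong A (λ {a} _ → ≡-trans (sym (∑-+ (words A m) _ _))
         (∑-cong (words A m) (λ {u} _ → sym (∑-signings-∷ a u f)))) ⟩
  ∑ A (λ a → ∑ (words A m) (λ u → ∑ (signings (a ∷ u)) f))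
    ≡⟨ ∑-words-suc A m _ ⟨
  ∑ (words A (suc m)) (λ u → ∑ (signings u) f) ∎
  where
  A± = A ++ map ℤ.-_ A
  F = λ a → ∑ (words A m) (λ u → ∑ (signings u) (f ∘ (a ∷_)))

words-All : ∀ {P : ℤ → Set} {A} → All P A → ∀ m → All (All P) (words A m)
words-All pA zero    = [] ∷ []
words-All pA (suc m) =
  All.concat⁺ (All.map⁺ (All.map (λ pa → All.map⁺ (All.map (pa ∷_) (words-All pA m))) pA))

∈-words : ∀ {A} m {w} → w ∈ words A m → All (_∈ A) w
∈-words m = All.lookup (words-All (All.tabulate (λ a∈A → a∈A)) m)

-- Permutation conditions as products of indicators.

∏ : List ℤ → (ℤ → ℕ) → ℕ
∏ []       h = 1
∏ (s ∷ ss) h = h s * ∏ ss h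

∏-cong : ∀ ss {g h : ℤ → ℕ} → (∀ {s} → s ∈ ss → g s ≡ h s) → ∏ ss g ≡ ∏ ss h
∏-cong []       eq = refl
∏-cong (s ∷ ss) eq = cong₂ _*_ (eq (here refl)) (∏-cong ss (eq ∘ there))

∏-∷ʳ : ∀ ss s h → ∏ (ss ++ s ∷ []) h ≡ h s * ∏ ss h
∏-∷ʳ []       s h = refl
∏-∷ʳ (t ∷ ss) s h rewrite ∏-∷ʳ ss s h = exchange (h t) (h s) (∏ ss h)
  where
  exchange : ∀ x y z → x * (y * z) ≡ y * (x * z)
  exchange = solve-∀

∏-zero : ∀ {ss s h} → s ∈ ss → h s ≡ 0 → ∏ ss h ≡ 0
∏-zero {h = h} (here {xs = ss} refl) hs≡0 = cong (_* ∏ ss h) hs≡0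
∏-zero {t ∷ _} {h = h} (there s∈ss) hs≡0 =
  ≡-trans (cong (h t *_) (∏-zero s∈ss hs≡0)) (ℕ.*-zeroʳ (h t))

∏-Pointwise : ∀ {R : ℤ → ℤ → Set} {ss ts g h} → Pointwise R ss ts →
  (∀ {s t} → R s t → g s ≡ h t) → ∏ ss g ≡ ∏ ts h
∏-Pointwise []       eq = refl
∏-Pointwise (r ∷ rs) eq = cong₂ _*_ (eq r) (∏-Pointwise rs eq)

count-∷ : ∀ a b w → count a (b ∷ w) ≡ b2n ⌊ a ℤ.≟ b ⌋ + count a w
count-∷ a b w with a ℤ.≟ b
... | yes _ = refl
... | no  _ = refl

∉⇒count≡0 : ∀ {a} w → a ∉ w → count a w ≡ 0
∉⇒count≡0         []      a∉w = refl
∉⇒count≡0 {a = a} (b ∷ w) a∉w with a ℤ.≟ b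
... | yes a≡b = contradiction (here a≡b) a∉w
... | no  _   = ∉⇒count≡0 w (a∉w ∘ there)

∈⇒count≢0 : ∀ {a w} → a ∈ w → count a w ≢ 0
∈⇒count≢0 {a} {b ∷ w} a∈w with a ℤ.≟ b | a∈w
... | yes _  | _           = λ ()
... | no a≢b | here a≡b    = contradiction a≡b a≢b
... | no _   | there a∈w′  = ∈⇒count≢0 a∈w′

-- Indicators valued in ℕ: products express conjunctions, and sums express alternatives that exclude
-- each other.
once never : List ℤ → ℤ → ℕ
once  w a = b2n ⌊ count a w ℕ.≟ 1 ⌋
never w a = b2n ⌊ count a w ℕ.≟ 0 ⌋

never-∉ : ∀ {a} w → a ∉ w → never w a ≡ 1
never-∉ w a∉w rewrite ∉⇒count≡0 w a∉w = refl

never-∈ : ∀ {a} w → a ∈ w → never w a ≡ 0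
never-∈ {a} w a∈w with count a w ℕ.≟ 0
... | yes c≡0 = contradiction c≡0 (∈⇒count≢0 a∈w)
... | no  _   = refl

onlyWithSign : List ℤ → ℤ → ℕ
onlyWithSign w s = once w s * never w (ℤ.- s)

b2n-∧ : ∀ p q → b2n (p ∧ q) ≡ b2n p * b2n q
b2n-∧ true  q = sym (ℕ.+-identityʳ _)
b2n-∧ false q = refl

b2n-isPerm : ∀ n w → b2n (isPerm n w) ≡ ∏ (range n) (once w)
b2n-isPerm n w = go (range n)
  where
  go : ∀ ss → b2n (foldr (λ i b → ⌊ count i w ℕ.≟ 1 ⌋ ∧ b) true ss) ≡ ∏ ss (once w)
  go []       = refl
  go (s ∷ ss) = ≡-trans (b2n-∧ ⌊ count s w ℕ.≟ 1 ⌋ _) (cong (once w s *_) (go ss))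

isPerm⇒count≡1 : ∀ n w → isPerm n w ≡ true → ∀ {i} → i ∈ range n → count i w ≡ 1
isPerm⇒count≡1 n w = go (range n)
  where
  go : ∀ ss → foldr (λ i b → ⌊ count i w ℕ.≟ 1 ⌋ ∧ b) true ss ≡ true →
       ∀ {i} → i ∈ ss → count i w ≡ 1
  go (s ∷ ss) eq i∈ with count s w ℕ.≟ 1 | i∈
  ... | yes c≡1 | here refl  = c≡1
  ... | yes _   | there i∈ss = go ss eq i∈ss
  go (s ∷ ss) () i∈ | no _ | _

count-absW : ∀ n w → count (ℤ.+ suc n) (absW w) ≡ count ℤ.-[1+ n ] w + count (ℤ.+ suc n) w
count-absW n []      = refl
count-absW n (b ∷ w) = begin
  count N (absW (b ∷ w))                      ≡⟨ count-∷ N (ℤ.+ ∣ b ∣) (absW w) ⟩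
  b2n ⌊ N ℤ.≟ ℤ.+ ∣ b ∣ ⌋ + count N (absW w)   ≡⟨ cong₂ _+_ (letter b) (count-absW n w) ⟩
  (b2n ⌊ -N ℤ.≟ b ⌋ + b2n ⌊ N ℤ.≟ b ⌋) + (count -N w + count N w)
    ≡⟨ interchange (b2n ⌊ -N ℤ.≟ b ⌋) _ _ _ ⟩
  (b2n ⌊ -N ℤ.≟ b ⌋ + count -N w) + (b2n ⌊ N ℤ.≟ b ⌋ + count N w)
    ≡⟨ cong₂ _+_ (count-∷ -N b w) (count-∷ N b w) ⟨
  count -N (b ∷ w) + count N (b ∷ w)          ∎
  where
  N = ℤ.+ suc n
  -N = ℤ.-[1+ n ]

  interchange : ∀ x y z w → (x + y) + (z + w) ≡ (x + z) + (y + w)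
  interchange = solve-∀

  letter : ∀ b → b2n ⌊ N ℤ.≟ ℤ.+ ∣ b ∣ ⌋ ≡ b2n ⌊ -N ℤ.≟ b ⌋ + b2n ⌊ N ℤ.≟ b ⌋
  letter (ℤ.+ m)    = refl
  -- The last indicator is 0, and the other two decisions reduce to the same Boolean test on `n` and
  -- `m`, which `isYes≗does` exposes.
  letter ℤ.-[1+ m ] = ≡-trans
    (cong b2n (≡-trans (isYes≗does (N ℤ.≟ ℤ.+ suc m)) (sym (isYes≗does (-N ℤ.≟ ℤ.-[1+ m ])))))
    (sym (ℕ.+-identityʳ _))

-- Two counts add up to 1 exactly when one is 1 and the other 0; the two cases exclude each other,
-- so their indicators add.
once-absW : ∀ n w →
  once (absW w) (ℤ.+ suc n) ≡ onlyWithSign w ℤ.-[1+ n ] + onlyWithSign w (ℤ.+ suc n)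
once-absW n w rewrite count-absW n w = split (count ℤ.-[1+ n ] w) (count (ℤ.+ suc n) w)
  where
  split : ∀ x y → b2n ⌊ x + y ℕ.≟ 1 ⌋ ≡
    b2n ⌊ x ℕ.≟ 1 ⌋ * b2n ⌊ y ℕ.≟ 0 ⌋ + b2n ⌊ y ℕ.≟ 1 ⌋ * b2n ⌊ x ℕ.≟ 0 ⌋
  split 0             0             = refl
  split 0             1             = refl
  split 0             (suc (suc y)) = refl
  split 1             0             = refl
  split 1             1             = refl
  split 1             (suc (suc y)) = refl
  split (suc (suc x)) 0             = refl
  split (suc (suc x)) 1             = refl
  split (suc (suc x)) (suc (suc y)) = refl

-- Choices of signs for the elements of [n].

range-suc : ∀ n → range (suc n) ≡ range n ++ ℤ.+ suc n ∷ []
range-suc n = ≡-trans (cong (map _) (sym (upTo-∷ʳ n))) (map-++ _ (upTo n) (n ∷ []))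

-- The sets obtained from [n] by a choice of sign for every element, each
-- listed in increasing order.
signedSets : ℕ → List (List ℤ)
signedSets zero    = [] ∷ []
signedSets (suc n) =
  map (ℤ.-[1+ n ] ∷_) (signedSets n) ++ map (_++ ℤ.+ suc n ∷ []) (signedSets n)

length-signedSets : ∀ n → length (signedSets n) ≡ 2 ^ n
length-signedSets zero    = refl
length-signedSets (suc n) = begin
  length (map (ℤ.-[1+ n ] ∷_) (signedSets n) ++ map (_++ ℤ.+ suc n ∷ []) (signedSets n))
    ≡⟨ length-++ (map (ℤ.-[1+ n ] ∷_) (signedSets n)) ⟩
  length (map (ℤ.-[1+ n ] ∷_) (signedSets n)) + length (map (_++ ℤ.+ suc n ∷ []) (signedSets n))
    ≡⟨ cong₂ _+_ (length-map _ (signedSets n)) (length-map _ (signedSets n)) ⟩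
  length (signedSets n) + length (signedSets n)
    ≡⟨ cong₂ _+_ (length-signedSets n) (≡-trans (length-signedSets n) (sym (ℕ.+-identityʳ _))) ⟩
  2 ^ suc n ∎

-- By `once-absW` the left side is a product of sums of two terms; expanding it gives one term for
-- each choice of signs. This sorts signed permutations by their set of letters.
∏-absW : ∀ n w →
  ∏ (range n) (once (absW w)) ≡ ∑ (signedSets n) (λ S → ∏ S (onlyWithSign w))
∏-absW zero    w = refl
∏-absW (suc n) w = begin
  ∏ (range (suc n)) (once (absW w))
    ≡⟨ cong (λ ss → ∏ ss (once (absW w))) (range-suc n) ⟩
  ∏ (range n ++ N ∷ []) (once (absW w))
    ≡⟨ ∏-∷ʳ (range n) N _ ⟩
  once (absW w) N * ∏ (range n) (once (absW w))
    ≡⟨ cong₂ _*_ (once-absW n w) (∏-absW n w) ⟩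
  (e -N + e N) * ∑ (signedSets n) (λ S → ∏ S e)
    ≡⟨ ℕ.*-distribʳ-+ _ (e -N) (e N) ⟩
  e -N * ∑ (signedSets n) (λ S → ∏ S e) + e N * ∑ (signedSets n) (λ S → ∏ S e)
    ≡⟨ cong₂ _+_ (∑-*ˡ (signedSets n) _ (e -N)) (∑-*ˡ (signedSets n) _ (e N)) ⟩
  ∑ (signedSets n) (λ S → ∏ (-N ∷ S) e) + ∑ (signedSets n) (λ S → e N * ∏ S e)
    ≡⟨ cong₂ _+_ (∑-map (-N ∷_) (signedSets n) _)
         (≡-trans (∑-map (_++ N ∷ []) (signedSets n) _)
                  (∑-cong (signedSets n) (λ {S} _ → ∏-∷ʳ S N e))) ⟨
  ∑ (map (-N ∷_) (signedSets n)) (λ S → ∏ S e) +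
  ∑ (map (_++ N ∷ []) (signedSets n)) (λ S → ∏ S e)
    ≡⟨ ∑-++ (map (-N ∷_) (signedSets n)) _ _ ⟨
  ∑ (signedSets (suc n)) (λ S → ∏ S e) ∎
  where
  N = ℤ.+ suc n
  -N = ℤ.-[1+ n ]
  e = onlyWithSign w

-- The same family as an inductive predicate, for induction on the choices of sign.
data SignedSet : ℕ → List ℤ → Set where
  []  : SignedSet 0 []
  neg : ∀ {n S} → SignedSet n S → SignedSet (suc n) (ℤ.-[1+ n ] ∷ S)
  pos : ∀ {n S} → SignedSet n S → SignedSet (suc n) (S ++ ℤ.+ suc n ∷ [])

∈-signedSets : ∀ n {S} → S ∈ signedSets n → SignedSet n S
∈-signedSets zero    (here refl) = []
∈-signedSets (suc n) S∈ with ∈-++⁻ (map (ℤ.-[1+ n ] ∷_) (signedSets n)) S∈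
... | inj₁ S∈ˡ with T , T∈ , refl ← ∈-map⁻ _ S∈ˡ = neg (∈-signedSets n T∈)
... | inj₂ S∈ʳ with T , T∈ , refl ← ∈-map⁻ _ S∈ʳ = pos (∈-signedSets n T∈)

range-signedSet : ∀ n → SignedSet n (range n)
range-signedSet zero    = []
range-signedSet (suc n) = subst (SignedSet (suc n)) (sym (range-suc n)) (pos (range-signedSet n))

length-signedSet : ∀ {n S} → SignedSet n S → length S ≡ n
length-signedSet []             = refl
length-signedSet (neg σ)        = cong suc (length-signedSet σ)
length-signedSet (pos {S = S} σ) =
  ≡-trans (length-++ S) (≡-trans (ℕ.+-comm (length S) 1) (cong suc (length-signedSet σ)))

∣∣-signedSet : ∀ {n S} → SignedSet n S → All (λ s → ∣ s ∣ ≤ n) S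
∣∣-signedSet []      = []
∣∣-signedSet (neg σ) = ℕ.≤-refl ∷ All.map ℕ.m≤n⇒m≤1+n (∣∣-signedSet σ)
∣∣-signedSet (pos σ) = All.++⁺ (All.map ℕ.m≤n⇒m≤1+n (∣∣-signedSet σ)) (ℕ.≤-refl ∷ [])

∣∣≤⇒< : ∀ {n} s → ∣ s ∣ ≤ n → s ℤ.< ℤ.+ suc n
∣∣≤⇒< (ℤ.+ m)    m≤n = ℤ.+<+ (s≤s m≤n)
∣∣≤⇒< ℤ.-[1+ m ] _   = ℤ.-<+

∣∣≤⇒> : ∀ {n} s → ∣ s ∣ ≤ n → ℤ.-[1+ n ] ℤ.< s
∣∣≤⇒> (ℤ.+ m)    _   = ℤ.-<+
∣∣≤⇒> ℤ.-[1+ m ] m<n = ℤ.-<- m<n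

-- The added element exceeds all others in absolute value, so it is the minimum or the maximum.
signedSet-sorted : ∀ {n S} → SignedSet n S → AllPairs ℤ._<_ S
signedSet-sorted []      = []
signedSet-sorted (neg σ) = All.map (λ {s} → ∣∣≤⇒> s) (∣∣-signedSet σ) ∷ signedSet-sorted σ
signedSet-sorted (pos σ) = AllPairs.++⁺ (signedSet-sorted σ) ([] ∷ [])
  (All.map (λ {s} ∣s∣≤n → ∣∣≤⇒< s ∣s∣≤n ∷ []) (∣∣-signedSet σ))

-- This keeps negatives of elements of `S` out of words over `S`, where the `never` factors are
-- therefore 1.
signedSet-asym : ∀ {n S} → SignedSet n S → ∀ {s t} → s ∈ S → t ∈ S → t ≢ ℤ.- s
signedSet-asym (neg {n} σ) = λ where
    (here refl) (here refl) ()
    (here refl) (there t∈)  refl → ℕ.1+n≰n (All.lookup (∣∣-signedSet σ) t∈)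
    (there s∈)  (here refl) eq   → tooLarge s∈ eq
    (there s∈)  (there t∈)       → signedSet-asym σ s∈ t∈
  where
  tooLarge : ∀ {s} → s ∈ _ → ℤ.-[1+ n ] ≢ ℤ.- s
  tooLarge {s} s∈ eq = ℕ.1+n≰n (subst (_≤ n)
    (≡-trans (sym (ℤ.∣-i∣≡∣i∣ s)) (cong ∣_∣ (sym eq))) (All.lookup (∣∣-signedSet σ) s∈))
signedSet-asym (pos {n} {S} σ) {s} {t} s∈ t∈ eq with ∈-++⁻ S s∈ | ∈-++⁻ S t∈
... | inj₁ s∈S         | inj₁ t∈S         = signedSet-asym σ s∈S t∈S eq
... | inj₁ s∈S         | inj₂ (here refl) = ℕ.1+n≰n (subst (_≤ n)
    (≡-trans (sym (ℤ.∣-i∣≡∣i∣ s)) (cong ∣_∣ (sym eq))) (All.lookup (∣∣-signedSet σ) s∈S))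
... | inj₂ (here refl) | inj₁ t∈S         = ℕ.1+n≰n (subst (_≤ n)
    (cong ∣_∣ eq) (All.lookup (∣∣-signedSet σ) t∈S))
... | inj₂ (here refl) | inj₂ (here refl) = contradiction eq λ ()

±-∷ʳ : ∀ A x → (A ++ x ∷ []) ++ map ℤ.-_ (A ++ x ∷ []) ↭ x ∷ ℤ.- x ∷ A ++ map ℤ.-_ A
±-∷ʳ A x
  rewrite map-++ ℤ.-_ A (x ∷ []) | ++-assoc A (x ∷ []) (map ℤ.-_ A ++ ℤ.- x ∷ [])
  = trans (Perm.shift x A (map ℤ.-_ A ++ ℤ.- x ∷ [])) (prep x append)
  where
  append : A ++ map ℤ.-_ A ++ ℤ.- x ∷ [] ↭ ℤ.- x ∷ A ++ map ℤ.-_ A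
  append rewrite sym (++-assoc A (map ℤ.-_ A) (ℤ.- x ∷ [])) =
    ↭-sym (Perm.∷↭∷ʳ (ℤ.- x) (A ++ map ℤ.-_ A))

signedRange-suc : ∀ n → signedRange (suc n) ↭ ℤ.+ suc n ∷ ℤ.-[1+ n ] ∷ signedRange n
signedRange-suc n =
  subst (λ A → A ++ map ℤ.-_ A ↭ ℤ.+ suc n ∷ ℤ.-[1+ n ] ∷ signedRange n) (sym (range-suc n))
        (±-∷ʳ (range n) (ℤ.+ suc n))

-- Puts the letters of `S` first in the signed alphabet, so that words using one of the remaining
-- letters can be discarded.
signedSet-alphabet : ∀ {n S} → SignedSet n S → S ++ map ℤ.-_ S ↭ signedRange n
signedSet-alphabet []                = refl
signedSet-alphabet (neg {n} {S} σ) =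
  trans (prep _ (Perm.shift (ℤ.+ suc n) S (map ℤ.-_ S)))
    (trans (swap _ _ (signedSet-alphabet σ)) (↭-sym (signedRange-suc n)))
signedSet-alphabet (pos {n} {S} σ) =
  trans (±-∷ʳ S (ℤ.+ suc n))
    (trans (prep _ (prep _ (signedSet-alphabet σ))) (↭-sym (signedRange-suc n)))

-- The order isomorphism between two sorted lists of equal length, as a relation.
Matched : List ℤ → List ℤ → ℤ → ℤ → Set
Matched S T s t = (s , t) ∈ zip S T

Both< : ℤ × ℤ → ℤ × ℤ → Set
Both< (s , t) (s′ , t′) = s ℤ.< s′ × t ℤ.< t′

All-zip : ∀ {P Q : ℤ → Set} {S T} → All P S → All Q T →
  All (λ st → P (proj₁ st) × Q (proj₂ st)) (zip S T)
All-zip []       _        = []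
All-zip (_ ∷ _)  []       = []
All-zip (p ∷ ps) (q ∷ qs) = (p , q) ∷ All-zip ps qs

zip-sorted : ∀ {S T} → AllPairs ℤ._<_ S → AllPairs ℤ._<_ T → AllPairs Both< (zip S T)
zip-sorted []        _         = []
zip-sorted (_ ∷ _)   []        = []
zip-sorted (s< ∷ ss) (t< ∷ ts) = All-zip s< t< ∷ zip-sorted ss ts

Matched-Pointwise : ∀ {S T} → length S ≡ length T → Pointwise (Matched S T) S T
Matched-Pointwise {[]}    {[]}    _  = []
Matched-Pointwise {s ∷ S} {t ∷ T} eq =
  here refl ∷ Pointwise.map there (Matched-Pointwise (ℕ.suc-injective eq))

-- Applied to the zip of two sorted lists, this compares both components at once and with the same
-- outcome.
comparable : ∀ {R : A → A → Set} {as a b} → AllPairs R as → a ∈ as → b ∈ as →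
  a ≡ b ⊎ R a b ⊎ R b a
comparable (_ ∷ _)   (here refl) (here refl) = inj₁ refl
comparable (Ra ∷ _)  (here refl) (there b∈)  = inj₂ (inj₁ (All.lookup Ra b∈))
comparable (Rb ∷ _)  (there a∈)  (here refl) = inj₂ (inj₂ (All.lookup Rb a∈))
comparable (_ ∷ Ras) (there a∈)  (there b∈)  = comparable Ras a∈ b∈

≟-refl : ∀ a → ⌊ a ℤ.≟ a ⌋ ≡ true
≟-refl a = ≡-trans (isYes≗does (a ℤ.≟ a)) (dec-true (a ℤ.≟ a) refl)

≟-≢ : ∀ {a b} → a ≢ b → ⌊ a ℤ.≟ b ⌋ ≡ false
≟-≢ {a} {b} a≢b = ≡-trans (isYes≗does (a ℤ.≟ b)) (dec-false (a ℤ.≟ b) a≢b)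

module OrderIso {S T} (S< : AllPairs ℤ._<_ S) (T< : AllPairs ℤ._<_ T) where

  private
    R = Matched S T

  lt-Matched : ∀ {s t s′ t′} → R s t → R s′ t′ → lt s s′ ≡ lt t t′
  lt-Matched {s} {t} {s′} {t′} r r′ with comparable (zip-sorted S< T<) r r′
  ... | inj₁ refl                = ≡-trans (lt-false ℤ.≤-refl) (sym (lt-false ℤ.≤-refl))
  ... | inj₂ (inj₁ (s< , t<)) = ≡-trans (lt-true s<) (sym (lt-true t<))
  ... | inj₂ (inj₂ (s> , t>)) =
    ≡-trans (lt-false (ℤ.<⇒≤ s>)) (sym (lt-false (ℤ.<⇒≤ t>)))

  ≟-Matched : ∀ {s t s′ t′} → R s t → R s′ t′ → ⌊ s ℤ.≟ s′ ⌋ ≡ ⌊ t ℤ.≟ t′ ⌋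
  ≟-Matched {s} {t} r r′ with comparable (zip-sorted S< T<) r r′
  ... | inj₁ refl                = ≡-trans (≟-refl s) (sym (≟-refl t))
  ... | inj₂ (inj₁ (s< , t<)) = ≡-trans (≟-≢ (ℤ.<⇒≢ s<)) (sym (≟-≢ (ℤ.<⇒≢ t<)))
  ... | inj₂ (inj₂ (s> , t>)) = ≡-trans (≟-≢ (≢-sym (ℤ.<⇒≢ s>))) (sym (≟-≢ (≢-sym (ℤ.<⇒≢ t>))))

  count-Matched : ∀ {s t w w′} → R s t → Pointwise R w w′ → count s w ≡ count t w′
  count-Matched                 r []                   = refl
  count-Matched {s} {t} r (_∷_ {x = a} {y = b} {w} {w′} r′ rs)
    rewrite count-∷ s a w | count-∷ t b w′ | ≟-Matched r r′ | count-Matched r rs = refl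

  evenAscOddDes-Matched : ∀ i {w w′} → Pointwise R w w′ → evenAscOddDes i w ≡ evenAscOddDes i w′
  evenAscOddDes-Matched i []            = refl
  evenAscOddDes-Matched i (_ ∷ [])      = refl
  evenAscOddDes-Matched i (r ∷ r′ ∷ rs) = cong₂ _+_
    (cong₂ (λ p q → b2n (if even i then p else q)) (lt-Matched r r′) (lt-Matched r′ r))
    (evenAscOddDes-Matched (suc i) (r′ ∷ rs))

-- Sums over the arrangements of a signed set.

∑-arrangements : ℕ → List ℤ → (List ℤ → ℕ) → ℕ
∑-arrangements n S f = ∑ (words S n) (λ w → ∏ S (once w) * f w)

-- The increasing bijection from `S` to `T`, applied letter by letter, preserves equality and order,
-- hence both the counts and the alternating descents.
∑-arrangements-altDes : ∀ {n S T} → SignedSet n S → SignedSet n T → ∀ (g : ℕ → ℕ) →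
  ∑-arrangements n S (g ∘ altDes) ≡ ∑-arrangements n T (g ∘ altDes)
∑-arrangements-altDes {n} {S} {T} σ τ g = ∑-words-Pointwise ST n λ ws → cong₂ _*_
  (∏-Pointwise ST (λ r → cong (λ c → b2n ⌊ c ℕ.≟ 1 ⌋) (count-Matched r ws)))
  (cong g (evenAscOddDes-Matched 1 ws))
  where
  open OrderIso (signedSet-sorted σ) (signedSet-sorted τ)
  ST = Matched-Pointwise (≡-trans (length-signedSet σ) (sym (length-signedSet τ)))

-- A word containing the negative of an element of `S` meets a vanishing `never` factor; on the
-- other words these factors are 1.
∑-onlyWithSign : ∀ {n S} → SignedSet n S → ∀ (f : List ℤ → ℕ) →
  ∑ (words (signedRange n) n) (λ w → ∏ S (onlyWithSign w) * f w) ≡ ∑-arrangements n S f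
∑-onlyWithSign {n} {S} σ f = begin
  ∑ (words (signedRange n) n) F          ≡⟨ ∑-words-↭ (signedSet-alphabet σ) n F ⟨
  ∑ (words (S ++ map ℤ.-_ S) n) F        ≡⟨ ∑-words-restrict S (map ℤ.-_ S) n F vanish ⟩
  ∑ (words S n) F
    ≡⟨ ∑-cong (words S n) (λ {w} w∈ → cong (_* f w) (∏-cong S (λ s∈S →
         ≡-trans (cong (once w _ *_) (never-∉ w (λ -s∈w →
                   signedSet-asym σ s∈S (All.lookup (∈-words n w∈) -s∈w) refl)))
                 (ℕ.*-identityʳ _)))) ⟩
  ∑-arrangements n S f                   ∎
  where
  F = λ w → ∏ S (onlyWithSign w) * f w

  vanish : ∀ {b w} → b ∈ map ℤ.-_ S → b ∈ w → F w ≡ 0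
  vanish {b} {w} b∈ b∈w with s , s∈S , refl ← ∈-map⁻ ℤ.-_ b∈ =
    cong (_* f w) (∏-zero s∈S
      (≡-trans (cong (once w s *_) (never-∈ w b∈w)) (ℕ.*-zeroʳ (once w s))))

-- Two groupings of the signed permutations.

∑-Sym : ∀ n (f : List ℤ → ℕ) → ∑ (Sym n) f ≡ ∑-arrangements n (range n) f
∑-Sym n f = ≡-trans (∑-filter (isPerm n) (words (range n) n) f)
  (∑-cong (words (range n) n) (λ {w} _ → cong (_* f w) (b2n-isPerm n w)))

-- Grouping by the set of letters: each of the 2ⁿ sets contributes as much as [n] itself.
∑-SignedSym-altDes : ∀ n (g : ℕ → ℕ) →
  ∑ (SignedSym n) (g ∘ altDes) ≡ 2 ^ n * ∑ (Sym n) (g ∘ altDes)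
∑-SignedSym-altDes n g = begin
  ∑ (SignedSym n) f
    ≡⟨ ∑-filter (isPerm n ∘ absW) ws f ⟩
  ∑ ws (λ w → b2n (isPerm n (absW w)) * f w)
    ≡⟨ ∑-cong ws (λ {w} _ → ≡-trans
         (cong (_* f w) (≡-trans (b2n-isPerm n (absW w)) (∏-absW n w)))
         (∑-*ʳ (signedSets n) _ (f w))) ⟩
  ∑ ws (λ w → ∑ (signedSets n) (λ S → ∏ S (onlyWithSign w) * f w))
    ≡⟨ ∑-swap ws (signedSets n) _ ⟩
  ∑ (signedSets n) (λ S → ∑ ws (λ w → ∏ S (onlyWithSign w) * f w))
    ≡⟨ ∑-cong (signedSets n) (λ S∈ → let σ = ∈-signedSets n S∈ in
         ≡-trans (∑-onlyWithSign σ f) (∑-arrangements-altDes σ (range-signedSet n) g)) ⟩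
  ∑ (signedSets n) (λ _ → ∑-arrangements n (range n) f)
    ≡⟨ ∑-const (signedSets n) _ ⟩
  length (signedSets n) * ∑-arrangements n (range n) f
    ≡⟨ cong₂ _*_ (length-signedSets n) (sym (∑-Sym n f)) ⟩
  2 ^ n * ∑ (Sym n) f ∎
  where
  f = g ∘ altDes
  ws = words (signedRange n) n

absW-signings : ∀ {u} → All (0ℤ ℤ.≤_) u → ∀ {w} → w ∈ signings u → absW w ≡ u
absW-signings []                  (here refl) = refl
absW-signings {a ∷ u} (0≤a ∷ 0≤u) w∈ with ∈-++⁻ (map (a ∷_) (signings u)) w∈
... | inj₁ w∈ˡ with v , v∈ , refl ← ∈-map⁻ (a ∷_) w∈ˡ =
  cong₂ _∷_ (ℤ.0≤i⇒+∣i∣≡i 0≤a) (absW-signings 0≤u v∈)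
... | inj₂ w∈ʳ with v , v∈ , refl ← ∈-map⁻ (ℤ.- a ∷_) w∈ʳ =
  cong₂ _∷_ (≡-trans (cong ℤ.+_ (ℤ.∣-i∣≡∣i∣ a)) (ℤ.0≤i⇒+∣i∣≡i 0≤a)) (absW-signings 0≤u v∈)

∈-range : ∀ n → All (λ i → 0ℤ ℤ.< i × i ℤ.< ℤ.+ suc n) (range n)
∈-range n = All.map⁺ (All.applyUpTo⁺₁ id n
  (λ i<n → ℤ.+<+ (s≤s z≤n) , ℤ.+<+ (s≤s i<n)))

-- Grouping by the permutation of absolute values. For `altDes`, comparison with the first grouping
-- gives type A.
∑-SignedSym-signings : ∀ n (f : List ℤ → ℕ) →
  ∑ (SignedSym n) f ≡ ∑ (Sym n) (λ u → ∑ (signings u) f)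
∑-SignedSym-signings n f = begin
  ∑ (SignedSym n) f
    ≡⟨ ∑-filter (isPerm n ∘ absW) (words (signedRange n) n) f ⟩
  ∑ (words (signedRange n) n) (λ w → b2n (isPerm n (absW w)) * f w)
    ≡⟨ ∑-words-signed (range n) n _ ⟩
  ∑ (words (range n) n) (λ u → ∑ (signings u) (λ w → b2n (isPerm n (absW w)) * f w))
    -- The letters of `u` are positive, so `absW` maps every signing back to `u`, and the indicator
    -- leaves the inner sum.
    ≡⟨ ∑-cong (words (range n) n) (λ {u} u∈ → ≡-trans
         (∑-cong (signings u) (λ {w} w∈ → cong (λ v → b2n (isPerm n v) * f w)
           (absW-signings (All.map (ℤ.<⇒≤ ∘ proj₁ ∘ All.lookup (∈-range n)) (∈-words n u∈)) w∈)))
         (sym (∑-*ˡ (signings u) f (b2n (isPerm n u))))) ⟩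
  ∑ (words (range n) n) (λ u → b2n (isPerm n u) * ∑ (signings u) f)
    ≡⟨ ∑-filter (isPerm n) (words (range n) n) _ ⟨
  ∑ (Sym n) (λ u → ∑ (signings u) f) ∎

-- Letters of a permutation and the two identities.

-- An upper bound on the counts passes directly to the tail of the word.
count≤1⇒distinct : ∀ w → (∀ {a} → a ∈ w → count a w ≤ 1) → AllPairs _≢_ w
count≤1⇒distinct []      _  = []
count≤1⇒distinct (b ∷ w) c≤1 =
  All.tabulate (λ { a∈w refl → b∉w a∈w }) ∷
  count≤1⇒distinct w (λ {a} a∈w → ℕ.≤-trans
    (ℕ.≤-trans (ℕ.m≤n+m (count a w) _) (ℕ.≤-reflexive (sym (count-∷ a b w)))) (c≤1 (there a∈w)))
  where
  b∉w : b ∉ w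
  b∉w b∈w = ∈⇒count≢0 b∈w (ℕ.n≤0⇒n≡0 (ℕ.≤-pred (subst (_≤ 1)
    (≡-trans (count-∷ b b w) (cong (λ p → b2n p + count b w) (≟-refl b))) (c≤1 (here refl)))))

Sym-letters : ∀ n {u} → u ∈ Sym n → All (Between (ℤ.+ suc n)) u × AllPairs _≢_ u
Sym-letters n {u} u∈ with u∈words , perm ← ∈-filter⁻ (λ w → isPerm n w Bool.≟ true) u∈ =
  All.map (All.lookup (∈-range n)) u∈range ,
  count≤1⇒distinct u (λ a∈u →
    ℕ.≤-reflexive (isPerm⇒count≡1 n u perm (All.lookup u∈range a∈u)))
  where
  u∈range = ∈-words n u∈words

-- The letter n + 1 in front makes the first letter of the word follow a descent, and the first
-- comparison counted is at position 1.
∑-signings-altDes : ∀ n {u} → u ∈ Sym n → ∀ k →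
  ∑ (signings u) (λ w → coeff (xpow (altDes w)) k) ≡ W (statsInf n u) k
∑-signings-altDes n {[]}    _  k = W-0 k
∑-signings-altDes n {b ∷ u} u∈ k with bu@((_ , b<∞) ∷ _) , u≢ ← Sym-letters n u∈ =
  ≡-trans (∑-signings-∷ b u _)
          (altSeries-descent (ℤ.+ suc n) 1 (ℤ.+ suc n) b u b<∞ bu u≢ k)

∑-signings-altDesB : ∀ n {u} → u ∈ Sym n → ∀ k →
  ∑ (signings u) (λ w → coeff (xpow (altDesB w)) k) ≡ W (statsZero n u) k
∑-signings-altDesB n {u} u∈ k with bu , u≢ ← Sym-letters n u∈ = begin
  altSeries 0 0ℤ u k
    ≡⟨ altSeries-W (ℤ.+ suc n) 0 true 0ℤ u ℤ.≤-refl (ℤ.+<+ (s≤s z≤n)) bu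
         (All.map (ℤ.<⇒≢ ∘ proj₁) bu ∷ u≢) k ⟩
  -- `alternates 0 (not true)` computes to `false`, so the leading 0, taken with positive sign, adds
  -- no power of x.
  shiftIf (not (lt 0ℤ (next (ℤ.+ suc n) u)) ∧ false) (W (statsZero n u)) k
    ≡⟨ cong (λ b → shiftIf b (W (statsZero n u)) k) (Bool.∧-zeroʳ (not (lt 0ℤ (next (ℤ.+ suc n) u)))) ⟩
  W (statsZero n u) k ∎

theorem1p1 : ∀ (n : ℕ) → 1 ≤ n →
    (((2 ^ n) ·P Ahat n) ≈P RHSA n) × (Bhat n ≈P RHSB n)
theorem1p1 n _ = typeA , typeB
  where
  typeA : ((2 ^ n) ·P Ahat n) ≈P RHSA n
  typeA k = begin
    coeff ((2 ^ n) ·P Ahat n) k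
      ≡⟨ coeff-·P (2 ^ n) (Ahat n) k ⟩
    2 ^ n * coeff (Ahat n) k
      ≡⟨ cong (2 ^ n *_) (coeff-sumP _ (Sym n) k) ⟩
    2 ^ n * ∑ (Sym n) (λ w → coeff (xpow (altDes w)) k)
      ≡⟨ ∑-SignedSym-altDes n (λ d → coeff (xpow d) k) ⟨
    ∑ (SignedSym n) (λ w → coeff (xpow (altDes w)) k)
      ≡⟨ ∑-SignedSym-signings n _ ⟩
    ∑ (Sym n) (λ u → ∑ (signings u) (λ w → coeff (xpow (altDes w)) k))
      ≡⟨ ∑-cong (Sym n) (λ u∈ → ∑-signings-altDes n u∈ k) ⟩
    ∑ (Sym n) (λ u → W (statsInf n u) k)
      ≡⟨ coeff-sumP _ (Sym n) k ⟨
    coeff (RHSA n) k ∎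

  typeB : Bhat n ≈P RHSB n
  typeB k = begin
    coeff (Bhat n) k
      ≡⟨ coeff-sumP _ (SignedSym n) k ⟩
    ∑ (SignedSym n) (λ w → coeff (xpow (altDesB w)) k)
      ≡⟨ ∑-SignedSym-signings n _ ⟩
    ∑ (Sym n) (λ u → ∑ (signings u) (λ w → coeff (xpow (altDesB w)) k))
      ≡⟨ ∑-cong (Sym n) (λ u∈ → ∑-signings-altDesB n u∈ k) ⟩
    ∑ (Sym n) (λ u → W (statsZero n u) k)
      ≡⟨ coeff-sumP _ (Sym n) k ⟨
    coeff (RHSB n) k ∎
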